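{- Let $K_m^-$ and $K_n^-$ be antibalanced signed complete graphs of order $m$ and $n$ respectively, and let $K_m^-\Box K_n^-$ be their Cartesian product. Then $$\operatorname{bdim}(K_m^-\Box K_n^-)=\begin{cases}\bar\nu(m), & \text{if } m\geq n,\\ \bar\nu(n), & \text{if } m\leq n,\end{cases}$$ where $\bar\nu(m)=\operatorname{bdim}(K_m^-)$.
   Context: A signed graph $\Sigma=(G,\sigma)$ is a graph $G=(V,E)$ with a function $\sigma:E\to\{+1,-1\}$. The sign of a cycle is the product of the signs of its edges; $\Sigma$ is balanced if it has no cycle of sign $-1$, and antibalanced if $-\Sigma=(G,-\sigma)$ is balanced. Let $\Omega=\{ -1,0,1\}$, with $\Omega^k\subset\mathbb{R}^k$ carrying the standard inner product $\langle\cdot,\cdot\rangle$. A vector valued switching function ($k$-switching function) for $\Sigma$ is a map $\zeta:V\to\Omega^k$ with $\langle\zeta(u),\zeta(v)\rangle\neq 0$ for every edge $uv\in E$; the switched signed graph $\Sigma^\zeta=(G,\sigma^\zeta)$ has $\sigma^\zeta(uv)=\sigma(uv)\operatorname{sgn}(\langle\zeta(u),\zeta(v)\rangle)$. The balancing dimension $\operatorname{bdim}(\Sigma)$ is the least integer $k\ge 1$ for which there is a $k$-switching function $\zeta:V\to\Omega^k$ such that $\Sigma^\zeta$ is all-positive (every edge has sign $+1$). $K_n^-$ denotes an antibalanced signed graph whose underlying graph is the complete graph $K_n$, and $\bar\nu(n)=\operatorname{bdim}(K_n^-)$. (This does not depend on the choice of antibalanced signature: all antibalanced signatures on $K_n$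 are equivalent under ordinary $\{\pm1\}$-switching, which preserves $\operatorname{bdim}$.) The Cartesian product $\Sigma_1\Box\Sigma_2$ of $\Sigma_1=(G_1,\sigma_1)$ and $\Sigma_2=(G_2,\sigma_2)$ is the Cartesian product $G_1\Box G_2$ of the underlying graphs, with signature $\sigma((u_i,v_j)(u_k,v_l))=\sigma_1(u_iu_k)$ if $j=l$, and $=\sigma_2(v_jv_l)$ if $i=k$. -}

module Defs where

open import Data.Empty using (⊥-elim)
open import Data.Fin.Base using (Fin)
open import Data.Fin.Properties as Fin using (all?; *↔×)
open import Data.Integer.Base as ℤ using (ℤ; 0ℤ; 1ℤ; -1ℤ; sign; _◃_)
import Data.Integer.Properties as ℤ
open import Data.List.Base as List using (List)
open import Data.List.Relation.Unary.Unique.Propositional using (Unique)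
open import Data.Nat.Base as ℕ using (ℕ; zero; suc; _≤_; z≤n; s≤s)
import Data.Nat.Properties as ℕ
open import Data.Product.Base using (Σ; ∃; ∃-syntax; _×_; _,_; proj₁; proj₂)
open import Data.Product.Function.NonDependent.Propositional using (_×-↔_)
open import Data.Sign.Base as Sign using (Sign; opposite)
import Data.Sign.Properties as Sign
open import Data.Sum.Base using (_⊎_; inj₁; inj₂)
open import Data.Vec.Base as Vec using (Vec; []; _∷_; lookup; tabulate; allPairs)
open import Data.Vec.Membership.Propositional using (_∈_)
open import Data.Vec.Membership.Propositional.Properties using (∈-tabulate⁺; ∈-allPairs⁺)
open import Data.Vec.Properties using (lookup∘tabulate)
open import Data.Vec.Relation.Unary.Any using (here; there)
open import Function.Base using (_∘_)
open import Function.Bundles using (_↔_; Inverse; mk⇔)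
open import Function.Construct.Composition using (_↔-∘_)
open import Function.Construct.Identity using (↔-id)
open import Function.Construct.Symmetry using (↔-sym)
open import Relation.Binary.Definitions using (DecidableEquality)
open import Relation.Binary.PropositionalEquality
open import Relation.Nullary using (¬_; Dec; yes; no; contradiction)
open import Relation.Nullary.Decidable as Dec using (_×-dec_; _⊎-dec_; ¬?)
open import Relation.Unary using (Decidable)

------------------------------------------------------------------------
-- Finite simple graphs and signed graphs

record Graph : Set₁ where
  field
    V          : Set
    order      : ℕ
    enum       : V ↔ Fin order
    Adj        : V → V → Set
    Adj?       : ∀ u v → Dec (Adj u v)
    Adj-sym    : ∀ {u v} → Adj u v → Adj v u
    Adj-irrefl : ∀ {v} → ¬ Adj v v

  index : V → Fin order
  index = Inverse.to enum

  vertex : Fin order → V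
  vertex = Inverse.from enum

  vertex-index : ∀ v → vertex (index v) ≡ v
  vertex-index = Inverse.strictlyInverseʳ enum

  _≟_ : DecidableEquality V
  u ≟ v = Dec.map′
    (λ eq → trans (sym (vertex-index u)) (trans (cong vertex eq) (vertex-index v)))
    (cong index) (index u Fin.≟ index v)

  infixr 5 _∷_

  data Walk : V → V → Set where
    []  : ∀ {v} → Walk v v
    _∷_ : ∀ {u v w} → Adj u v → Walk v w → Walk u w

  length : ∀ {u v} → Walk u v → ℕ
  length []      = 0
  length (_ ∷ w) = suc (length w)

  vertices : ∀ {u v} → Walk u v → List V
  vertices {u} []      = u List.∷ List.[]
  vertices {u} (_ ∷ w) = u List.∷ vertices w

  -- A cycle is a path with at least two edges together with an edge joining
  -- its ends.
  record Cycle : Set where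
    field
      {start end} : V
      path        : Walk start end
      distinct    : Unique (vertices path)
      2≤length    : 2 ≤ length path
      closing     : Adj end start

-- An edge uv may be given by any proof of Adj u v or of Adj v u; σ-edge makes σ
-- a function of the unordered edge (in particular, independent of the proof).
record SignedGraph (G : Graph) : Set where
  open Graph G
  field
    σ      : ∀ {u v} → Adj u v → Sign
    σ-edge : ∀ {u v} (p : Adj u v) (q : Adj v u) → σ p ≡ σ q

  σ-irr : ∀ {u v} (p q : Adj u v) → σ p ≡ σ q
  σ-irr p q = trans (σ-edge p (Adj-sym p)) (σ-edge (Adj-sym p) q)

  walkSign : ∀ {u v} → Walk u v → Sign
  walkSign []      = Sign.+
  walkSign (p ∷ w) = σ p Sign.* walkSign w

  cycleSign : Cycle → Sign
  cycleSign c = walkSign (Cycle.path c) Sign.* σ (Cycle.closing c)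

module _ {G : Graph} where
  open Graph G
  open SignedGraph

  Balanced : SignedGraph G → Set
  Balanced S = ∀ c → cycleSign S c ≢ Sign.-

  negate : SignedGraph G → SignedGraph G
  negate S .σ p        = opposite (σ S p)
  negate S .σ-edge p q = cong opposite (σ-edge S p q)

  Antibalanced : SignedGraph G → Set
  Antibalanced S = Balanced (negate S)

  AllPositive : SignedGraph G → Set
  AllPositive S = ∀ u v (p : Adj u v) → σ S p ≡ Sign.+

------------------------------------------------------------------------
-- Vectors over Ω

data Ω : Set where
  neg nul pos : Ω

⟦_⟧ : Ω → ℤ
⟦ neg ⟧ = -1ℤ
⟦ nul ⟧ = 0ℤ
⟦ pos ⟧ = 1ℤ

⟨_,_⟩ : ∀ {k} → Vec Ω k → Vec Ω k → ℤ
⟨ []     , []     ⟩ = 0ℤ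
⟨ x ∷ xs , y ∷ ys ⟩ = ⟦ x ⟧ ℤ.* ⟦ y ⟧ ℤ.+ ⟨ xs , ys ⟩

⟨⟩-comm : ∀ {k} (xs ys : Vec Ω k) → ⟨ xs , ys ⟩ ≡ ⟨ ys , xs ⟩
⟨⟩-comm []       []       = refl
⟨⟩-comm (x ∷ xs) (y ∷ ys) = cong₂ ℤ._+_ (ℤ.*-comm ⟦ x ⟧ ⟦ y ⟧) (⟨⟩-comm xs ys)

------------------------------------------------------------------------
-- Vector valued switching

record SwitchingFunction (G : Graph) (k : ℕ) : Set where
  open Graph G
  field
    ζ       : V → Vec Ω k
    nonzero : ∀ u v → Adj u v → ⟨ ζ u , ζ v ⟩ ≢ 0ℤ

-- The value sign 0ℤ ≡ Sign.+ is never used, since the inner products along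
-- edges are nonzero.
switch : ∀ {G k} → SignedGraph G → SwitchingFunction G k → SignedGraph G
switch {G} S Z = record
  { σ      = λ {u} {v} p → σ p Sign.* sign ⟨ ζ u , ζ v ⟩
  ; σ-edge = λ {u} {v} p q →
      cong₂ Sign._*_ (σ-edge p q) (cong sign (⟨⟩-comm (ζ u) (ζ v)))
  }
  where open SignedGraph S
        open SwitchingFunction Z

PositivelySwitchable : ∀ {G} → SignedGraph G → ℕ → Set
PositivelySwitchable {G} S k =
  1 ≤ k × Σ (SwitchingFunction G k) λ Z → AllPositive (switch S Z)

IsLeast : (ℕ → Set) → ℕ → Set
IsLeast P k = P k × (∀ j → P j → k ≤ j)

------------------------------------------------------------------------
-- The least dimension exists: positive switchability is decidable, and some
-- dimension always works.

least : ∀ {P : ℕ → Set} → Decidable P → ∀ n → P n → ∃ (IsLeast P)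
least P? zero p = zero , p , λ _ _ → z≤n
least {P} P? (suc n) p with P? zero
... | yes p₀ = zero , p₀ , λ _ _ → z≤n
... | no ¬p₀ with least (P? ∘ suc) n p
...   | k , pk , min = suc k , pk , min′
  where
  min′ : ∀ j → P j → suc k ≤ j
  min′ zero    p₀ = contradiction p₀ ¬p₀
  min′ (suc j) pj = s≤s (min j pj)

Searchable : Set → Set₁
Searchable A = ∀ {P : A → Set} → Decidable P → Dec (∃ P)

anyΩ? : Searchable Ω
anyΩ? {P} P? = Dec.map′ to from (P? neg ⊎-dec P? nul ⊎-dec P? pos)
  where
  to : P neg ⊎ P nul ⊎ P pos → ∃ P
  to (inj₁ p)        = neg , p
  to (inj₂ (inj₁ p)) = nul , p
  to (inj₂ (inj₂ p)) = pos , p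
  from : ∃ P → P neg ⊎ P nul ⊎ P pos
  from (neg , p) = inj₁ p
  from (nul , p) = inj₂ (inj₁ p)
  from (pos , p) = inj₂ (inj₂ p)

anyVec? : ∀ {A} → Searchable A → ∀ n → Searchable (Vec A n)
anyVec? any? zero    P? = Dec.map′ ([] ,_) (λ { ([] , p) → p }) (P? [])
anyVec? any? (suc n) P? = Dec.map′
  (λ { (x , xs , p) → x ∷ xs , p }) (λ { (x ∷ xs , p) → x , xs , p })
  (any? λ x → anyVec? any? n λ xs → P? (x ∷ xs))

module _ {G : Graph} (S : SignedGraph G) where
  open Graph G
  open SignedGraph S

  private
    Good : ∀ {k} → (V → Vec Ω k) → V → V → Set
    Good ζ u v = (p : Adj u v) →
      ⟨ ζ u , ζ v ⟩ ≢ 0ℤ × σ p Sign.* sign ⟨ ζ u , ζ v ⟩ ≡ Sign.+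

    good? : ∀ {k} (ζ : V → Vec Ω k) u v → Dec (Good ζ u v)
    good? ζ u v with Adj? u v
    ... | no ¬p = yes λ p → contradiction p ¬p
    ... | yes p = Dec.map′
      (λ { (nz , eq) q → nz , trans (cong (Sign._* _) (σ-irr q p)) eq }) (λ g → g p)
      (¬? (⟨ ζ u , ζ v ⟩ ℤ.≟ 0ℤ) ×-dec (σ p Sign.* sign ⟨ ζ u , ζ v ⟩ Sign.≟ Sign.+))

    allV? : ∀ {P : V → Set} → Decidable P → Dec (∀ v → P v)
    allV? {P} P? = Dec.map′
      (λ f v → subst P (vertex-index v) (f (index v))) (λ f i → f (vertex i))
      (all? (P? ∘ vertex))

  positivelySwitchable? : Decidable (PositivelySwitchable S)
  positivelySwitchable? k = (1 ℕ.≤? k) ×-dec Dec.map′ to from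
    (anyVec? (anyVec? anyΩ? k) order λ xs →
       allV? λ u → allV? λ v → good? (lookup xs ∘ index) u v)
    where
    to : (∃[ xs ] ∀ u v → Good (lookup xs ∘ index) u v) → _
    to (xs , g) =
      record { ζ = lookup xs ∘ index ; nonzero = λ u v p → proj₁ (g u v p) } ,
      λ u v p → proj₂ (g u v p)
    from : Σ (SwitchingFunction G k) (λ Z → AllPositive (switch S Z)) →
           ∃[ xs ] ∀ u v → Good (lookup xs ∘ index) u v
    from (Z , all+) = tabulate (ζ ∘ vertex) , λ u v → good u v
      where
      open SwitchingFunction Z
      ζ≡ : ∀ u → ζ u ≡ lookup (tabulate (ζ ∘ vertex)) (index u)
      ζ≡ u = sym (trans (lookup∘tabulate (ζ ∘ vertex) (index u))
                        (cong ζ (vertex-index u)))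
      good : ∀ u v → Good (lookup (tabulate (ζ ∘ vertex)) ∘ index) u v
      good u v p rewrite sym (ζ≡ u) | sym (ζ≡ v) = nonzero u v p , all+ u v p

  -- One coordinate for each ordered pair (a , b): on an edge ab it is 1 at a,
  -- σ(ab) at b and 0 elsewhere; on a non-edge it vanishes.
  private
    ω : Sign → Ω
    ω Sign.+ = pos
    ω Sign.- = neg

    coord : V → V × V → Ω
    coord u (a , b) with Adj? a b | u ≟ a | u ≟ b
    ... | no _  | _     | _     = nul
    ... | yes _ | yes _ | _     = pos
    ... | yes p | no _  | yes _ = ω (σ p)
    ... | yes _ | no _  | no _  = nul

    pos*ω : ∀ s → ⟦ pos ⟧ ℤ.* ⟦ ω s ⟧ ≡ s ◃ 1
    pos*ω Sign.+ = refl
    pos*ω Sign.- = refl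

    ω*pos : ∀ s → ⟦ ω s ⟧ ℤ.* ⟦ pos ⟧ ≡ s ◃ 1
    ω*pos Sign.+ = refl
    ω*pos Sign.- = refl

    term : ∀ {u v} (p : Adj u v) ab → ∃[ c ]
      ⟦ coord u ab ⟧ ℤ.* ⟦ coord v ab ⟧ ≡ σ p ◃ c × (ab ≡ (u , v) → 1 ≤ c)
    term {u} {v} p (a , b) with Adj? a b | u ≟ a | u ≟ b | v ≟ a | v ≟ b
    ... | no ¬q | _ | _ | _ | _ = 0 , refl , λ { refl → contradiction p ¬q }
    ... | yes q | yes refl | _ | yes refl | _ = contradiction p Adj-irrefl
    ... | yes q | yes refl | _ | no _ | yes refl =
      1 , trans (pos*ω (σ q)) (cong (_◃ 1) (σ-irr q p)) , λ _ → s≤s z≤n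
    ... | yes q | yes refl | _ | no _ | no v≢b =
      0 , refl , λ { refl → contradiction refl v≢b }
    ... | yes q | no u≢a | yes refl | yes refl | _ =
      1 , trans (ω*pos (σ q)) (cong (_◃ 1) (σ-edge q p)) , λ _ → s≤s z≤n
    ... | yes q | no u≢a | yes refl | no _ | yes refl = contradiction p Adj-irrefl
    ... | yes q | no u≢a | yes refl | no _ | no _ =
      0 , ℤ.*-zeroʳ ⟦ ω (σ q) ⟧ , λ { refl → contradiction refl u≢a }
    ... | yes q | no u≢a | no _ | _ | _ =
      0 , refl , λ { refl → contradiction refl u≢a }

    total : ∀ {u v} (p : Adj u v) {k} (es : Vec (V × V) k) → ∃[ c ]
      ⟨ Vec.map (coord u) es , Vec.map (coord v) es ⟩ ≡ σ p ◃ c ×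
      ((u , v) ∈ es → 1 ≤ c)
    total p []       = 0 , refl , λ ()
    total p (e ∷ es) with term p e | total p es
    ... | c , eq , pos₁ | d , eq′ , pos₂ =
      c ℕ.+ d ,
      trans (cong₂ ℤ._+_ eq eq′) (sym (ℤ.◃-distrib-+ (σ p) c d)) ,
      λ { (here refl) → ℕ.≤-trans (pos₁ refl) (ℕ.m≤m+n c d)
        ; (there i)   → ℕ.≤-trans (pos₂ i) (ℕ.m≤n+m d c) }

    pairs : Vec (V × V) (order ℕ.* order)
    pairs = allPairs (tabulate vertex) (tabulate vertex)

    ∈-pairs : ∀ u v → (u , v) ∈ pairs
    ∈-pairs u v = ∈-allPairs⁺ (∈-vs u) (∈-vs v)
      where
      ∈-vs : ∀ w → w ∈ tabulate vertex
      ∈-vs w = subst (_∈ tabulate vertex) (vertex-index w) (∈-tabulate⁺ vertex (index w))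

    vec : V → Vec Ω (suc (order ℕ.* order))
    vec u = nul ∷ Vec.map (coord u) pairs

    vec-good : ∀ {u v} (p : Adj u v) → ∃[ c ] ⟨ vec u , vec v ⟩ ≡ σ p ◃ suc c
    vec-good {u} {v} p with total p pairs
    ... | zero  , _  , 1≤0 = contradiction (1≤0 (∈-pairs u v)) λ ()
    ... | suc c , eq , _   = c , trans (ℤ.+-identityˡ _) eq

    ◃≢0 : ∀ s c → s ◃ suc c ≢ 0ℤ
    ◃≢0 Sign.+ c ()
    ◃≢0 Sign.- c ()

  switchable-exists : ∃ (PositivelySwitchable S)
  switchable-exists = suc (order ℕ.* order) , s≤s z≤n ,
    record
      { ζ       = vec
      ; nonzero = λ u v p eq →
          ◃≢0 (σ p) _ (trans (sym (proj₂ (vec-good p))) eq)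
      } ,
    λ u v p → trans
      (cong (λ i → σ p Sign.* sign i) (proj₂ (vec-good p)))
      (trans (cong (σ p Sign.*_) (ℤ.sign-◃ (σ p) (suc _))) (Sign.s*s≡+ (σ p)))

  abstract
    bdim : ℕ
    bdim = proj₁ (least positivelySwitchable? _ (proj₂ switchable-exists))

    bdim-isLeast : IsLeast (PositivelySwitchable S) bdim
    bdim-isLeast = proj₂ (least positivelySwitchable? _ (proj₂ switchable-exists))

------------------------------------------------------------------------
-- Complete graphs

K : ℕ → Graph
K n = record
  { V          = Fin n
  ; order      = n
  ; enum       = ↔-id (Fin n)
  ; Adj        = _≢_
  ; Adj?       = λ u v → ¬? (u Fin.≟ v)
  ; Adj-sym    = ≢-sym
  ; Adj-irrefl = λ v≢v → v≢v refl
  }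

allNegative : (G : Graph) → SignedGraph G
allNegative G = record { σ = λ _ → Sign.- ; σ-edge = λ _ _ → refl }

allNegative-antibalanced : ∀ G → Antibalanced (allNegative G)
allNegative-antibalanced G c eq = contradiction
  (trans (sym eq) (trans (Sign.*-identityʳ _) (walk+ (Cycle.path c)))) λ ()
  where
  open Graph G
  open SignedGraph (negate (allNegative G))
  walk+ : ∀ {u v} (w : Walk u v) → walkSign w ≡ Sign.+
  walk+ []      = refl
  walk+ (_ ∷ w) = walk+ w

-- bdim is the same for every antibalanced signature on K n, so it is read off
-- from the all-negative one.
ν̄ : ℕ → ℕ
ν̄ n = bdim (allNegative (K n))

------------------------------------------------------------------------
-- Cartesian products

infixr 7 _□ᴳ_ _□_

_□ᴳ_ : Graph → Graph → Graph
G □ᴳ H = record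
  { V          = G.V × H.V
  ; order      = G.order ℕ.* H.order
  ; enum       = ↔-sym *↔× ↔-∘ (G.enum ×-↔ H.enum)
  ; Adj        = λ (u , v) (u′ , v′) → (v ≡ v′ × G.Adj u u′) ⊎ (u ≡ u′ × H.Adj v v′)
  ; Adj?       = λ (u , v) (u′ , v′) →
      ((v H.≟ v′) ×-dec G.Adj? u u′) ⊎-dec ((u G.≟ u′) ×-dec H.Adj? v v′)
  ; Adj-sym    = λ { (inj₁ (eq , p)) → inj₁ (sym eq , G.Adj-sym p)
                   ; (inj₂ (eq , p)) → inj₂ (sym eq , H.Adj-sym p) }
  ; Adj-irrefl = λ { (inj₁ (_ , p)) → G.Adj-irrefl p
                   ; (inj₂ (_ , p)) → H.Adj-irrefl p }
  }
  where module G = Graph G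
        module H = Graph H

_□_ : ∀ {G H} → SignedGraph G → SignedGraph H → SignedGraph (G □ᴳ H)
_□_ {G} {H} S T = record
  { σ      = λ { (inj₁ (_ , p)) → S.σ p
               ; (inj₂ (_ , q)) → T.σ q }
  ; σ-edge = λ { (inj₁ (_    , p)) (inj₁ (_ , q))    → S.σ-edge p q
               ; (inj₁ (refl , _)) (inj₂ (_ , q))    → ⊥-elim (Graph.Adj-irrefl H q)
               ; (inj₂ (refl , _)) (inj₁ (_ , q))    → ⊥-elim (Graph.Adj-irrefl G q)
               ; (inj₂ (_    , p)) (inj₂ (_ , q))    → T.σ-edge p q }
  }
  where module S = SignedGraph S
        module T = SignedGraph T

{-# OPTIONS --safe #-}

-- An antibalanced signature on a complete graph is an ordinary switching of the
-- all-negative one, and such switchings can be absorbed into ζ by negating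
-- vectors.  For m , n ≤ N, the Latin square (i , j) ↦ i + j mod N sends
-- neighbours in K m □ K n to distinct vertices of K N, so a switching function
-- for the latter pulls back to the product.  Conversely, each factor embeds in
-- the product as a fibre.
module Submission where

open import Defs
open import Data.Fin.Base as Fin using (Fin; toℕ)
import Data.Fin.Properties as Fin
open import Data.Integer.Base as ℤ using (0ℤ; sign; _◃_)
import Data.Integer.Properties as ℤ
open import Data.List.Relation.Unary.All as All using ()
open import Data.List.Relation.Unary.AllPairs as AllPairs using ()
open import Data.Nat.Base as ℕ using (ℕ; suc; _≤_; _<_; _≥_; _+_; _∸_; z≤n; s≤s; NonZero)
open import Data.Nat.DivMod using (_%_; _mod_; m%n<n; m<n⇒m%n≡m; [m+n]%n≡m%n; %-distribˡ-+)
import Data.Nat.Properties as ℕ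
open import Data.Product.Base using (_×_; _,_; proj₁; proj₂; Σ-syntax)
open import Data.Sign.Base as Sign using (Sign; opposite)
import Data.Sign.Properties as Sign
open import Data.Sum.Base using (inj₁; inj₂)
open import Data.Vec.Base as Vec using (Vec; []; _∷_)
open import Relation.Binary.PropositionalEquality
open import Relation.Nullary using (contradiction)

open Graph using (V; Adj)
open SignedGraph using (σ; σ-edge; σ-irr)

-- Scaling vectors over `Ω` by signs.

infixr 8 _⊙_

_⊙_ : Sign → Ω → Ω
Sign.+ ⊙ x   = x
Sign.- ⊙ neg = pos
Sign.- ⊙ nul = nul
Sign.- ⊙ pos = neg

⟦⊙⟧ : ∀ s x → ⟦ s ⊙ x ⟧ ≡ (s ◃ 1) ℤ.* ⟦ x ⟧
⟦⊙⟧ Sign.+ neg = refl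
⟦⊙⟧ Sign.+ nul = refl
⟦⊙⟧ Sign.+ pos = refl
⟦⊙⟧ Sign.- neg = refl
⟦⊙⟧ Sign.- nul = refl
⟦⊙⟧ Sign.- pos = refl

⟨⊙,⟩ : ∀ s {k} (xs ys : Vec Ω k) →
       ⟨ Vec.map (s ⊙_) xs , ys ⟩ ≡ (s ◃ 1) ℤ.* ⟨ xs , ys ⟩
⟨⊙,⟩ s []       []       = sym (ℤ.*-zeroʳ (s ◃ 1))
⟨⊙,⟩ s (x ∷ xs) (y ∷ ys) = begin
  ⟦ s ⊙ x ⟧ ℤ.* ⟦ y ⟧ ℤ.+ ⟨ Vec.map (s ⊙_) xs , ys ⟩
    ≡⟨ cong₂ ℤ._+_ (cong (ℤ._* ⟦ y ⟧) (⟦⊙⟧ s x)) (⟨⊙,⟩ s xs ys) ⟩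
  (s ◃ 1) ℤ.* ⟦ x ⟧ ℤ.* ⟦ y ⟧ ℤ.+ (s ◃ 1) ℤ.* ⟨ xs , ys ⟩
    ≡⟨ cong (ℤ._+ _) (ℤ.*-assoc (s ◃ 1) ⟦ x ⟧ ⟦ y ⟧) ⟩
  (s ◃ 1) ℤ.* (⟦ x ⟧ ℤ.* ⟦ y ⟧) ℤ.+ (s ◃ 1) ℤ.* ⟨ xs , ys ⟩
    ≡⟨ ℤ.*-distribˡ-+ (s ◃ 1) (⟦ x ⟧ ℤ.* ⟦ y ⟧) ⟨ xs , ys ⟩ ⟨
  (s ◃ 1) ℤ.* (⟦ x ⟧ ℤ.* ⟦ y ⟧ ℤ.+ ⟨ xs , ys ⟩) ∎
  where open ≡-Reasoning

⟨⊙,⊙⟩ : ∀ s t {k} (xs ys : Vec Ω k) →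
        ⟨ Vec.map (s ⊙_) xs , Vec.map (t ⊙_) ys ⟩ ≡ (s ◃ 1) ℤ.* ((t ◃ 1) ℤ.* ⟨ xs , ys ⟩)
⟨⊙,⊙⟩ s t xs ys = begin
  ⟨ Vec.map (s ⊙_) xs , Vec.map (t ⊙_) ys ⟩   ≡⟨ ⟨⊙,⟩ s xs (Vec.map (t ⊙_) ys) ⟩
  (s ◃ 1) ℤ.* ⟨ xs , Vec.map (t ⊙_) ys ⟩      ≡⟨ cong ((s ◃ 1) ℤ.*_) (⟨⟩-comm xs _) ⟩
  (s ◃ 1) ℤ.* ⟨ Vec.map (t ⊙_) ys , xs ⟩      ≡⟨ cong ((s ◃ 1) ℤ.*_) (⟨⊙,⟩ t ys xs) ⟩
  (s ◃ 1) ℤ.* ((t ◃ 1) ℤ.* ⟨ ys , xs ⟩)       ≡⟨ cong (λ i → (s ◃ 1) ℤ.* ((t ◃ 1) ℤ.* i)) (⟨⟩-comm ys xs) ⟩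
  (s ◃ 1) ℤ.* ((t ◃ 1) ℤ.* ⟨ xs , ys ⟩)       ∎
  where open ≡-Reasoning

◃1*≢0 : ∀ s {i} → i ≢ 0ℤ → (s ◃ 1) ℤ.* i ≢ 0ℤ
◃1*≢0 s i≢0 eq with ℤ.i*j≡0⇒i≡0∨j≡0 (s ◃ 1) eq
◃1*≢0 Sign.+ i≢0 eq | inj₁ ()
◃1*≢0 Sign.- i≢0 eq | inj₁ ()
... | inj₂ i≡0 = i≢0 i≡0

-- Nonvanishing matters: `sign 0ℤ` is `Sign.+`, so the equation fails at `i = 0ℤ` for `s = Sign.-`.
sign-◃1* : ∀ s {i} → i ≢ 0ℤ → sign ((s ◃ 1) ℤ.* i) ≡ s Sign.* sign i
sign-◃1* s {i} i≢0 = trans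
  (ℤ.sign-* (s ◃ 1) i {{ℤ.≢-nonZero (◃1*≢0 s i≢0)}})
  (cong (Sign._* sign i) (ℤ.sign-◃ s 1))

switched-sign : ∀ s t a b → ((s Sign.* t) Sign.* a) Sign.* (s Sign.* (t Sign.* b)) ≡ a Sign.* b
switched-sign Sign.+ Sign.+ a      b      = refl
switched-sign Sign.+ Sign.- Sign.+ Sign.+ = refl
switched-sign Sign.+ Sign.- Sign.+ Sign.- = refl
switched-sign Sign.+ Sign.- Sign.- b      = refl
switched-sign Sign.- Sign.+ Sign.+ Sign.+ = refl
switched-sign Sign.- Sign.+ Sign.+ Sign.- = refl
switched-sign Sign.- Sign.+ Sign.- b      = refl
switched-sign Sign.- Sign.- a      Sign.+ = refl
switched-sign Sign.- Sign.- a      Sign.- = refl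

-- Pulling back switching functions along graph homomorphisms.

module _ {G H : Graph} {S : SignedGraph G} {T : SignedGraph H}
  (f : V G → V H) (f-adj : ∀ {u v} → Adj G u v → Adj H (f u) (f v))
  (s : V G → Sign)
  (σ-f : ∀ {u v} (p : Adj G u v) → σ S p ≡ (s u Sign.* s v) Sign.* σ T (f-adj p))
  where

  -- Scaling `ζ (f u)` by `s u` multiplies each inner product by `s u` and `s v`, the same factor by
  -- which `σ-f` lets the signatures differ. Only a homomorphism is asked for, since the Latin
  -- square is in general not injective.
  switchable-pullback : ∀ {k} → PositivelySwitchable T k → PositivelySwitchable S k
  switchable-pullback (1≤k , Z , all+) = 1≤k ,
    record
      { ζ       = ζ′
      ; nonzero = λ u v p eq → ◃1*≢0 (s u) (◃1*≢0 (s v) (nz p))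
          (trans (sym (⟨⊙,⊙⟩ (s u) (s v) (ζ (f u)) (ζ (f v)))) eq)
      } ,
    positive
    where
    open SwitchingFunction Z
    ζ′ : V G → Vec Ω _
    ζ′ u = Vec.map (s u ⊙_) (ζ (f u))

    nz : ∀ {u v} → Adj G u v → ⟨ ζ (f u) , ζ (f v) ⟩ ≢ 0ℤ
    nz p = nonzero _ _ (f-adj p)

    positive : ∀ u v (p : Adj G u v) → σ S p Sign.* sign ⟨ ζ′ u , ζ′ v ⟩ ≡ Sign.+
    positive u v p = begin
      σ S p Sign.* sign ⟨ ζ′ u , ζ′ v ⟩
        ≡⟨ cong₂ Sign._*_ (σ-f p) sign-ζ′ ⟩
      ((s u Sign.* s v) Sign.* σ T (f-adj p)) Sign.* (s u Sign.* (s v Sign.* sign ⟨ ζ (f u) , ζ (f v) ⟩))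
        ≡⟨ switched-sign (s u) (s v) (σ T (f-adj p)) _ ⟩
      σ T (f-adj p) Sign.* sign ⟨ ζ (f u) , ζ (f v) ⟩
        ≡⟨ all+ _ _ (f-adj p) ⟩
      Sign.+ ∎
      where
      open ≡-Reasoning
      sign-ζ′ : sign ⟨ ζ′ u , ζ′ v ⟩ ≡ s u Sign.* (s v Sign.* sign ⟨ ζ (f u) , ζ (f v) ⟩)
      sign-ζ′ = trans (cong sign (⟨⊙,⊙⟩ (s u) (s v) (ζ (f u)) (ζ (f v))))
        (trans (sign-◃1* (s u) (◃1*≢0 (s v) (nz p)))
               (cong (s u Sign.*_) (sign-◃1* (s v) (nz p))))

  bdim-pullback : bdim S ≤ bdim T
  bdim-pullback = proj₂ (bdim-isLeast S) (bdim T)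
    (switchable-pullback (proj₁ (bdim-isLeast T)))

-- Antibalanced signatures on complete graphs.

-- The hypothesis has the form to which `cycleSign` of a negated triangle unfolds: path edges `a`
-- and `b`, the `Sign.+` of the empty walk, closing edge `c`.
triangle : ∀ a b c → (opposite a Sign.* (opposite b Sign.* Sign.+)) Sign.* opposite c ≢ Sign.- →
           b ≡ (opposite a Sign.* opposite c) Sign.* Sign.-
triangle Sign.+ Sign.+ Sign.+ ≢- = contradiction refl ≢-
triangle Sign.+ Sign.+ Sign.- ≢- = refl
triangle Sign.+ Sign.- Sign.+ ≢- = refl
triangle Sign.+ Sign.- Sign.- ≢- = contradiction refl ≢-
triangle Sign.- Sign.+ Sign.+ ≢- = refl
triangle Sign.- Sign.+ Sign.- ≢- = contradiction refl ≢-
triangle Sign.- Sign.- Sign.+ ≢- = contradiction refl ≢-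
triangle Sign.- Sign.- Sign.- ≢- = refl

-- Triangles through a root vertex suffice: each edge avoiding the root lies in one, and the other
-- two sides determine its sign.
antibalanced-K : ∀ {n} (S : SignedGraph (K n)) → Antibalanced S →
  Σ[ s ∈ (Fin n → Sign) ] (∀ {u v} (p : u ≢ v) → σ S p ≡ (s u Sign.* s v) Sign.* Sign.-)
antibalanced-K {ℕ.zero} S anti = (λ ()) , λ { {()} }
antibalanced-K {suc n}  S anti = s , λ {u} {v} → σ≡ u v
  where
  0≢ : (i : Fin n) → Fin.zero ≢ Fin.suc i
  0≢ i ()

  -- The root Fin.zero is joined to every other vertex, so s is forced by s zero = +.
  s : Fin (suc n) → Sign
  s Fin.zero    = Sign.+
  s (Fin.suc i) = opposite (σ S (0≢ i))

  opp-opp : ∀ a → a ≡ opposite a Sign.* Sign.-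
  opp-opp Sign.+ = refl
  opp-opp Sign.- = refl

  σ≡ : ∀ u v (p : u ≢ v) → σ S p ≡ (s u Sign.* s v) Sign.* Sign.-
  σ≡ Fin.zero    Fin.zero    p = contradiction refl p
  σ≡ Fin.zero    (Fin.suc j) p = trans (σ-irr S p (0≢ j)) (opp-opp _)
  σ≡ (Fin.suc i) Fin.zero    p = trans (σ-edge S p (0≢ i))
    (trans (opp-opp _) (cong (Sign._* Sign.-) (sym (Sign.*-identityʳ (s (Fin.suc i))))))
  σ≡ (Fin.suc i) (Fin.suc j) p = trans
    (triangle (σ S (0≢ i)) (σ S p) (σ S (≢-sym (0≢ j))) (anti cycle))
    -- The cycle traverses its closing edge towards the root, while `s` reads that edge from the
    -- root.
    (cong (λ a → (opposite (σ S (0≢ i)) Sign.* opposite a) Sign.* Sign.-)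
      (σ-edge S (≢-sym (0≢ j)) (0≢ j)))
    where
    cycle : Graph.Cycle (K (suc n))
    cycle = record
      { path     = 0≢ i Graph.∷ p Graph.∷ Graph.[]
      ; distinct = (0≢ i All.∷ 0≢ j All.∷ All.[]) AllPairs.∷
                   (p All.∷ All.[]) AllPairs.∷ All.[] AllPairs.∷ AllPairs.[]
      ; 2≤length = s≤s (s≤s z≤n)
      ; closing  = ≢-sym (0≢ j)
      }

-- Cancellation modulo `N`.

-- Adding `N ∸ j` undoes adding `j` modulo `N`; by `j ≤ N` the truncated subtraction is exact.
[x+j]%N-invert : ∀ {N x j} .{{_ : NonZero N}} → x < N → j ≤ N →
                 ((x + j) % N + (N ∸ j) % N) % N ≡ x
[x+j]%N-invert {N} {x} {j} x<N j≤N = begin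
  ((x + j) % N + (N ∸ j) % N) % N  ≡⟨ %-distribˡ-+ (x + j) (N ∸ j) N ⟨
  (x + j + (N ∸ j)) % N            ≡⟨ cong (_% N) (ℕ.+-assoc x j (N ∸ j)) ⟩
  (x + (j + (N ∸ j))) % N          ≡⟨ cong (λ a → (x + a) % N) (ℕ.m+[n∸m]≡n j≤N) ⟩
  (x + N) % N                      ≡⟨ [m+n]%n≡m%n x N ⟩
  x % N                            ≡⟨ m<n⇒m%n≡m x<N ⟩
  x                                ∎
  where open ≡-Reasoning

+-cancelʳ-mod : ∀ {N x y j} .{{_ : NonZero N}} → x < N → y < N → j ≤ N →
                (x + j) mod N ≡ (y + j) mod N → x ≡ y
+-cancelʳ-mod {N} {x} {y} {j} x<N y<N j≤N eq = begin
  x                                ≡⟨ [x+j]%N-invert x<N j≤N ⟨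
  ((x + j) % N + (N ∸ j) % N) % N  ≡⟨ cong (λ a → (a + (N ∸ j) % N) % N) eq% ⟩
  ((y + j) % N + (N ∸ j) % N) % N  ≡⟨ [x+j]%N-invert y<N j≤N ⟩
  y                                ∎
  where
  open ≡-Reasoning
  eq% : (x + j) % N ≡ (y + j) % N
  -- `mod` is `fromℕ<` applied to the remainder.
  eq% = Fin.fromℕ<-injective _ _ (m%n<n (x + j) N) (m%n<n (y + j) N) eq

-- Bounds for the product.

module _ {m n : ℕ} (S : SignedGraph (K m)) (T : SignedGraph (K n))
  (S-anti : Antibalanced S) (T-anti : Antibalanced T) where

  private
    s = proj₁ (antibalanced-K S S-anti)
    t = proj₁ (antibalanced-K T T-anti)
    σS : ∀ {u v} (p : u ≢ v) → σ S p ≡ (s u Sign.* s v) Sign.* Sign.-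
    σS = proj₂ (antibalanced-K S S-anti)
    σT : ∀ {u v} (p : u ≢ v) → σ T p ≡ (t u Sign.* t v) Sign.* Sign.-
    σT = proj₂ (antibalanced-K T T-anti)

    -- Switching is an involution, so `σS` and `σT` can be read backwards, giving the all-negative
    -- signature as a switching of `S` or `T`.
    cancel : ∀ a → Sign.- ≡ a Sign.* (a Sign.* Sign.-)
    cancel Sign.+ = refl
    cancel Sign.- = refl

    -- Along an edge of one factor the other coordinate is fixed, so its switching sign `c` occurs
    -- at both ends and squares to `Sign.+`.
    common-factorʳ : ∀ a b c → a Sign.* b ≡ (a Sign.* c) Sign.* (b Sign.* c)
    common-factorʳ Sign.+ Sign.+ Sign.+ = refl
    common-factorʳ Sign.+ Sign.+ Sign.- = refl
    common-factorʳ Sign.+ Sign.- Sign.+ = refl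
    common-factorʳ Sign.+ Sign.- Sign.- = refl
    common-factorʳ Sign.- Sign.+ Sign.+ = refl
    common-factorʳ Sign.- Sign.+ Sign.- = refl
    common-factorʳ Sign.- Sign.- Sign.+ = refl
    common-factorʳ Sign.- Sign.- Sign.- = refl

    common-factorˡ : ∀ a b c → a Sign.* b ≡ (c Sign.* a) Sign.* (c Sign.* b)
    common-factorˡ a b c = trans (common-factorʳ a b c)
      (cong₂ Sign._*_ (Sign.*-comm a c) (Sign.*-comm b c))

  -- The vertex of the second factor picks out a fibre carrying `S`, which `s` switches to
  -- all-negative.
  ν̄ˡ≤bdim-□ : Fin n → ν̄ m ≤ bdim (S □ T)
  ν̄ˡ≤bdim-□ v = bdim-pullback (_, v) (λ p → inj₁ (refl , p)) s
    λ {a} {b} p → trans (cancel (s a Sign.* s b)) (cong ((s a Sign.* s b) Sign.*_) (sym (σS p)))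

  ν̄ʳ≤bdim-□ : Fin m → ν̄ n ≤ bdim (S □ T)
  ν̄ʳ≤bdim-□ u = bdim-pullback (u ,_) (λ p → inj₂ (refl , p)) t
    λ {a} {b} p → trans (cancel (t a Sign.* t b)) (cong ((t a Sign.* t b) Sign.*_) (sym (σT p)))

  -- A common bound `N` treats both cases at once: it is later taken to be the larger order.
  bdim-□≤ν̄ : ∀ {N} .{{_ : NonZero N}} → m ≤ N → n ≤ N → bdim (S □ T) ≤ ν̄ N
  bdim-□≤ν̄ {N} m≤N n≤N = bdim-pullback latin latin-adj (λ (u , v) → s u Sign.* t v) σ-latin
    where
    latin : Fin m × Fin n → Fin N
    latin (u , v) = (toℕ u + toℕ v) mod N

    <Nˡ : (u : Fin m) → toℕ u < N
    <Nˡ u = ℕ.<-≤-trans (Fin.toℕ<n u) m≤N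

    <Nʳ : (v : Fin n) → toℕ v < N
    <Nʳ v = ℕ.<-≤-trans (Fin.toℕ<n v) n≤N

    latin-adj : ∀ {x y} → Adj (K m □ᴳ K n) x y → latin x ≢ latin y
    latin-adj {u , v} {u′ , _} (inj₁ (refl , u≢u′)) eq =
      u≢u′ (Fin.toℕ-injective (+-cancelʳ-mod (<Nˡ u) (<Nˡ u′) (ℕ.<⇒≤ (<Nʳ v)) eq))
    latin-adj {u , v} {_ , v′} (inj₂ (refl , v≢v′)) eq =
      -- Here the fixed summand is the left one, so both sums are commuted before cancelling.
      v≢v′ (Fin.toℕ-injective (+-cancelʳ-mod (<Nʳ v) (<Nʳ v′) (ℕ.<⇒≤ (<Nˡ u))
        (subst₂ (λ a b → a mod N ≡ b mod N)
          (ℕ.+-comm (toℕ u) (toℕ v)) (ℕ.+-comm (toℕ u) (toℕ v′)) eq)))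

    σ-latin : ∀ {x y} (p : Adj (K m □ᴳ K n) x y) → σ (S □ T) p ≡
      ((s (proj₁ x) Sign.* t (proj₂ x)) Sign.* (s (proj₁ y) Sign.* t (proj₂ y))) Sign.* Sign.-
    σ-latin {u , v} {u′ , _} (inj₁ (refl , p)) =
      trans (σS p) (cong (Sign._* Sign.-) (common-factorʳ (s u) (s u′) (t v)))
    σ-latin {u , v} {_ , v′} (inj₂ (refl , p)) =
      trans (σT p) (cong (Sign._* Sign.-) (common-factorˡ (t v) (t v′) (s u)))

proposition2p6 : (m n : ℕ) → 1 ≤ m → 1 ≤ n →
    (Km⁻ : SignedGraph (K m)) (Kn⁻ : SignedGraph (K n)) →
    Antibalanced Km⁻ → Antibalanced Kn⁻ →
    (m ≥ n → bdim (Km⁻ □ Kn⁻) ≡ ν̄ m) × (m ≤ n → bdim (Km⁻ □ Kn⁻) ≡ ν̄ n)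
-- Matching on `suc` supplies the vertices `Fin.zero` that select fibres, and the nonzero modulus.
proposition2p6 (suc _) (suc _) _ _ Km⁻ Kn⁻ Km-anti Kn-anti =
  (λ m≥n → ℕ.≤-antisym
    (bdim-□≤ν̄ Km⁻ Kn⁻ Km-anti Kn-anti ℕ.≤-refl m≥n)
    (ν̄ˡ≤bdim-□ Km⁻ Kn⁻ Km-anti Kn-anti Fin.zero)) ,
  (λ m≤n → ℕ.≤-antisym
    (bdim-□≤ν̄ Km⁻ Kn⁻ Km-anti Kn-anti m≤n ℕ.≤-refl)
    (ν̄ʳ≤bdim-□ Km⁻ Kn⁻ Km-anti Kn-anti Fin.zero))
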